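{- Let $H$ be a graph. Every $n$-vertex $H$-graph with $n\geq 2$ has boolean-width at most $\max\{1,2\|H\|\}\cdot\log n$.
   Context: All graphs are finite, undirected, loopless, and may have multiple edges. $\|H\|$ denotes the number of edges of $H$ (counted with multiplicity). Logarithms are binary. For $A\subseteq V(G)$, $\overline{A}=V(G)\setminus A$. Let $H$ be a (multi)graph. A graph $G$ is an $H$-graph if there are a subdivision $H'$ of $H$ and a collection $\mathcal{M}=\{M_v\}_{v\in V(G)}$ of non-empty subsets of $V(H')$, each inducing a connected subgraph of $H'$, such that $G$ is (isomorphic to) the intersection graph of $\mathcal{M}$. A branch decomposition of $G$ is a pair $(T,\delta)$ where $T$ is a full binary rooted tree (that is, every non-leaf vertex has degree 3) and $\delta$ is a bijection from the leaves of $T$ to $V(G)$. For $w\in V(T)$, $V_w$ is the set of vertices of $G$ in bijection with the leaves of the subtree of $T$ rooted at $w$. For $A\subseteq V(G)$, two subsets $X,Y\subseteq A$ are neighborhood equivalent with respect to $A$ if $N(X)\cap\overline{A}=N(Y)\cap\overline{A}$; this is an equivalence relation on the subsets of $A$ and $\operatorname{nec}(A)$ denotes its number of equivalence classes. The boolean-width of $(T,\delta)$ is the maximum of $\log(\operatorname{nec}(V_w))$ over all $w\in V(T)$, and the boolean-width of $G$ is the minimum boolean-width of a branch decomposition of $G$. -}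

module Defs where

open import Data.Bool.Base using (Bool; true; false; T)
import Data.Bool.Properties as Bool
open import Data.Fin.Base using (Fin; zero; suc; inject₁; toℕ)
open import Data.Fin.Properties using (any?; toℕ-inject₁) renaming (_≟_ to _≟ᶠ_)
open import Data.Fin.Relation.Unary.Top using (view; ‵fromℕ; ‵inject₁)
open import Data.Fin.Subset using (Subset; inside; outside; _∩_; ∁)
open import Data.Fin.Subset.Properties using (_∈?_; _⊆?_)
open import Data.List.Base using (List; []; _∷_; _++_; map; filter; deduplicate; length)
open import Data.Nat.Base using (ℕ; zero; suc; _*_; _^_; _≤_)
open import Data.Nat.Properties using (1+n≢n)
open import Data.Product.Base using (Σ; ∃; _×_; _,_; proj₁)
open import Data.Product.Properties using (≡-dec)
open import Data.Sum.Base using (_⊎_; inj₁; inj₂)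
open import Data.Tree.Binary using (Tree; leaf; node)
open import Data.Unit.Base using (⊤)
open import Data.Vec.Base using ([]; _∷_; tabulate)
import Data.Vec.Properties as Vec
open import Function.Base using (_∘_)
open import Function.Bundles using (_↔_; _⇔_; Inverse)
open import Level using (0ℓ)
open import Relation.Binary.Core using (REL; Rel)
open import Relation.Binary.Construct.Closure.ReflexiveTransitive using (Star)
open import Relation.Binary.Definitions using (Decidable)
open import Relation.Binary.PropositionalEquality using (_≡_; _≢_; refl; cong; module ≡-Reasoning)
open import Relation.Nullary.Decidable using (does; _×-dec_; _⊎-dec_)
open import Relation.Unary using (Satisfiable; _≬_)

-- Loopless multigraphs with vertex set V and edge set E.  They are
-- undirected: the order of the two ends of an edge is only an artefact of the
-- encoding, and everything below that talks about adjacency ignores it.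
-- Finite graphs are those with V = Fin n and E = Fin m.
record Graph (V E : Set) : Set where
  field
    src tgt  : E → V
    loopless : ∀ e → src e ≢ tgt e

  ends : E → V × V
  ends e = src e , tgt e

  Joins : E → V → V → Set
  Joins e u v = ends e ≡ (u , v) ⊎ ends e ≡ (v , u)

  Adjacent : Rel V 0ℓ
  Adjacent u v = ∃ λ e → Joins e u v

  Simple : Set
  Simple = ∀ {e f u v} → Joins e u v → Joins f u v → e ≡ f

  Connected : Set
  Connected = ∀ u v → Star Adjacent u v

open Graph

‖_‖ : ∀ {V m} → Graph V (Fin m) → ℕ
‖_‖ {m = m} _ = m

-- The subgraph induced by a set of vertices, given by its characteristic
-- function.
_[_] : ∀ {V E} (G : Graph V E) (M : V → Bool) →
       Graph (Σ V (T ∘ M)) (Σ E λ e → T (M (src G e)) × T (M (tgt G e)))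
G [ M ] = record
  { src      = λ (e , p , _) → src G e , p
  ; tgt      = λ (e , _ , q) → tgt G e , q
  ; loopless = λ (e , _) eq → loopless G e (cong proj₁ eq)
  }

-- The subdivision in which each edge e is replaced by the path
--   src e — (e , 0) — (e , 1) — ⋯ — (e , s e ∸ 1) — tgt e
-- with s e new inner vertices and hence s e + 1 edges (e , 0) , … , (e , s e),
-- numbered along the path.
module _ {V E : Set} (H : Graph V E) (s : E → ℕ) where

  SubVertex SubEdge : Set
  SubVertex = V ⊎ Σ E (Fin ∘ s)
  SubEdge   = Σ E (Fin ∘ suc ∘ s)

  subSrc subTgt : SubEdge → SubVertex
  subSrc (e , zero)  = inj₁ (src H e)
  subSrc (e , suc i) = inj₂ (e , i)
  subTgt (e , i) with view i
  ... | ‵fromℕ     = inj₁ (tgt H e)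
  ... | ‵inject₁ j = inj₂ (e , j)

  private
    position : SubVertex → ℕ
    position (inj₁ _)       = 0
    position (inj₂ (_ , i)) = suc (toℕ i)

    position-subSrc : ∀ e i → position (subSrc (e , i)) ≡ toℕ i
    position-subSrc e zero    = refl
    position-subSrc e (suc i) = refl

    subSrc-inj₁ : ∀ e i {v} → subSrc (e , i) ≡ inj₁ v → src H e ≡ v
    subSrc-inj₁ e zero refl = refl

    noLoop : ∀ d → subSrc d ≢ subTgt d
    noLoop (e , i) eq with view i
    ... | ‵fromℕ     = loopless H e (subSrc-inj₁ e _ eq)
    ... | ‵inject₁ j = 1+n≢n (begin
      suc (toℕ j)                       ≡⟨ cong position eq ⟨
      position (subSrc (e , inject₁ j)) ≡⟨ position-subSrc e (inject₁ j) ⟩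
      toℕ (inject₁ j)                   ≡⟨ toℕ-inject₁ j ⟩
      toℕ j                             ∎)
      where open ≡-Reasoning

  subdivide : Graph SubVertex SubEdge
  subdivide = record { src = subSrc ; tgt = subTgt ; loopless = noLoop }

-- G is the intersection graph of the family M indexed by its own vertices.
-- Members of M at different vertices may coincide as sets.
record IsIntersectionGraph {V E W : Set} (G : Graph V E) (M : V → W → Bool) : Set where
  field
    simple   : Simple G
    adjacent : ∀ u v → u ≢ v → Adjacent G u v ⇔ ((T ∘ M u) ≬ (T ∘ M v))

-- Since M is indexed by the vertices of G, "isomorphic to the intersection
-- graph" amounts to "is the intersection graph".
record _IsGraphOver_ {V E V′ E′ : Set} (G : Graph V E) (H : Graph V′ E′) : Set where
  field
    s              : E′ → ℕ
    M              : V → SubVertex H s → Bool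
    nonEmpty       : ∀ v → Satisfiable (T ∘ M v)
    connected      : ∀ v → Connected (subdivide H s [ M v ])
    isIntersection : IsIntersectionGraph G M

subsets : ∀ n → List (Subset n)
subsets zero    = [] ∷ []
subsets (suc n) = map (outside ∷_) (subsets n) ++ map (inside ∷_) (subsets n)

module _ {n m} (G : Graph (Fin n) (Fin m)) where

  adjacent? : Decidable (Adjacent G)
  adjacent? u v = any? λ e → (ends G e ≟ (u , v)) ⊎-dec (ends G e ≟ (v , u))
    where _≟_ = ≡-dec _≟ᶠ_ _≟ᶠ_

  -- This may contain vertices of X; they play no role below, as N X is only
  -- used outside a superset of X.
  N : Subset n → Subset n
  N X = tabulate λ v → does (any? λ u → (u ∈? X) ×-dec adjacent? u v)

  NbhdEquivalent : Subset n → Rel (Subset n) 0ℓ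
  NbhdEquivalent A X Y = N X ∩ ∁ A ≡ N Y ∩ ∁ A

  nbhdEquivalent? : ∀ A → Decidable (NbhdEquivalent A)
  nbhdEquivalent? A X Y = Vec.≡-dec Bool._≟_ (N X ∩ ∁ A) (N Y ∩ ∁ A)

  -- deduplicate keeps exactly one representative of each class.
  nec : Subset n → ℕ
  nec A = length (deduplicate (nbhdEquivalent? A) (filter (_⊆? A) (subsets n)))

-- A real x ≥ 0 is represented by its set of rational lower bounds p / q ≤ x
-- with p, q natural, i.e. by the relation "p ≤ q · x".
ℝ≥0 : Set₁
ℝ≥0 = REL ℕ ℕ 0ℓ

infix  4 _≤ᴿ_
infixl 7 _·_

_≤ᴿ_ : Rel ℝ≥0 0ℓ
x ≤ᴿ y = ∀ p q → x p q → y p q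

-- p ≤ q · log₂ a  iff  2 ^ p ≤ a ^ q; meant for a ≥ 1.
log : ℕ → ℝ≥0
log a p q = 2 ^ p ≤ a ^ q

-- p ≤ q · (k · x)  iff  p ≤ (q · k) · x.
_·_ : ℕ → ℝ≥0 → ℝ≥0
(k · x) p q = x p (q * k)

-- These are the supremum and infimum.  They are attained when the family takes
-- finitely many values and at least one, as below for graphs with a vertex.
-- The minimum of an empty family is infinite.
maximum minimum : {I : Set} → (I → ℝ≥0) → ℝ≥0
maximum x p q = ∃ λ i → x i p q
minimum x p q = ∀ i → x i p q

-- Rooted trees in which every non-leaf vertex has exactly two children.
FullBinaryTree : Set
FullBinaryTree = Tree ⊤ ⊤

data Leaf : FullBinaryTree → Set where
  here  : ∀ {x} → Leaf (leaf x)
  left  : ∀ {l x r} → Leaf l → Leaf (node l x r)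
  right : ∀ {l x r} → Leaf r → Leaf (node l x r)

data Vertex : FullBinaryTree → Set where
  root  : ∀ {t} → Vertex t
  left  : ∀ {l x r} → Vertex l → Vertex (node l x r)
  right : ∀ {l x r} → Vertex r → Vertex (node l x r)

below : ∀ {t} → Leaf t → Vertex t → Bool
below _         root      = true
below (left ℓ)  (left w)  = below ℓ w
below (right ℓ) (right w) = below ℓ w
below (left _)  (right _) = false
below (right _) (left _)  = false

record BranchDecomposition {n m} (G : Graph (Fin n) (Fin m)) : Set where
  field
    tree : FullBinaryTree
    δ    : Leaf tree ↔ Fin n

  verticesBelow : Vertex tree → Subset n
  verticesBelow w = tabulate λ v → below (Inverse.from δ v) w

  width : ℝ≥0
  width = maximum λ w → log (nec G (verticesBelow w))

booleanWidth : ∀ {n m} → Graph (Fin n) (Fin m) → ℝ≥0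
booleanWidth G = minimum {BranchDecomposition G} BranchDecomposition.width

{-# OPTIONS --safe #-}
module Submission where

-- Assign to each vertex of the subdivision a level: isolated vertices of H get
-- distinct levels below h, all other vertices of H get level h, and the inner
-- vertices of each edge get increasing levels above h.  Order the vertices v of
-- G by the least level in M v, and take the caterpillar whose subtrees are the
-- single vertices and the initial segments of this order.
--
-- Consider an initial segment A, cut at level t.  If t < h, then every edge
-- leaving A joins two vertices whose sets contain the isolated vertex of level
-- t.  If t ≥ h, walk inside M v from a vertex of level ≤ t to a vertex x of
-- M v ∩ M u, where v ∈ A and u ∉ A are adjacent: x lies on an edge e of H such
-- that M v contains either all of e from level t up to x, or all of e from its
-- end back to x.  Hence for one of the 2‖H‖ directed edges, u is adjacent to
-- every v′ ∈ A that covers at least as long a stretch as v.  So the neighbourhood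
-- of X ⊆ A outside A depends only on 2‖H‖ maxima, each with at most 1 + ∣A∣ ≤ n
-- possible values (one more for X = ∅), unless A is everything.

open import Defs
open import Data.Bool.Base using (Bool; true; T; if_then_else_)
open import Data.Bool.Properties using (T?)
open import Data.Fin.Base as Fin
  using (Fin; zero; suc; toℕ; fromℕ<; funToFin; finToFun; combine; remQuot; punchIn; punchOut)
open import Data.Fin.Properties as Fin
  using (any?; toℕ-fromℕ<; toℕ-injective; toℕ<n; finToFun-funToFin; injective⇒≤; remQuot-combine;
         punchInᵢ≢i; punchIn-punchOut; punchOut-punchIn; punchOut-cong)
open import Data.Fin.Relation.Unary.Top using (view; ‵fromℕ; ‵inject₁)
open import Data.Fin.Subset using (Subset; _∈_; _∉_; _⊆_; _∩_; ∁; ∣_∣)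
open import Data.Fin.Subset.Properties
  using (_∈?_; _⊆?_; ∈⊤; ∣p∣≤n; ∣p∣≡n⇒p≡⊤; p⊆q⇒∣p∣≤∣q∣; p⊂q⇒∣p∣<∣q∣; x∈p∩q⁺; x∈p∩q⁻; x∈∁p⇒x∉p;
         ⊆-antisym)
open import Data.List.Base using ([]; _∷_; deduplicate; length; lookup; allFin)
open import Data.List.Extrema.Nat using (argmax; f[xs]≤f[argmax])
open import Data.List.Membership.Propositional.Properties using (∈-allFin; ∈-lookup)
open import Data.List.Relation.Unary.All as All using (All; []; _∷_)
open import Data.List.Relation.Unary.All.Properties as All using (all-filter)
open import Data.List.Relation.Unary.AllPairs using (AllPairs; []; _∷_)
import Data.List.Relation.Unary.AllPairs.Properties as AllPairs
open import Data.Nat.Base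
  using (ℕ; zero; suc; _≤_; _<_; _+_; _*_; _∸_; _^_; _⊔_; z≤n; s≤s; s≤s⁻¹; z<s; >-nonZero)
open import Data.Nat.Properties
open import Data.Product.Base using (∃; ∃₂; _×_; _,_; proj₁; proj₂; uncurry)
open import Data.Sum.Base using (_⊎_; inj₁; inj₂)
open import Data.Tree.Binary using (leaf; node)
open import Data.Unit.Base using (tt)
open import Data.Vec.Base using (tabulate)
open import Data.Vec.Properties using (lookup∘tabulate; lookup⇒[]=; []=⇒lookup)
open import Function.Base using (_∘_; id)
open import Function.Bundles using (_↔_; Inverse; Equivalence; mk↔ₛ′)
open import Level using (0ℓ)
open import Relation.Binary.Construct.Closure.ReflexiveTransitive using (Star; ε; _◅_)
open import Relation.Binary.Core using (Rel)
open import Relation.Binary.Definitions using () renaming (Decidable to Decidable₂)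
open import Relation.Binary.PropositionalEquality
  using (_≡_; _≢_; refl; sym; trans; cong; subst; module ≡-Reasoning)
open import Relation.Nullary using (¬_; yes; no; contradiction)
open import Relation.Nullary.Decidable using (does; dec-true; _×-dec_; _⊎-dec_; _→-dec_)
open import Relation.Unary using (Pred; Decidable)

open Graph

-- Tabulated subsets and counting of equivalence classes

module _ {n} {P : Pred (Fin n) 0ℓ} (P? : Decidable P) where

  ∈-tabulate⁺ : ∀ {v} → P v → v ∈ tabulate (does ∘ P?)
  ∈-tabulate⁺ {v} p = lookup⇒[]= v _ (trans (lookup∘tabulate _ v) (dec-true (P? v) p))

  ∈-tabulate⁻ : ∀ {v} → v ∈ tabulate (does ∘ P?) → P v
  ∈-tabulate⁻ {v} v∈ with P? v | trans (sym (lookup∘tabulate (does ∘ P?) v)) ([]=⇒lookup v∈)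
  ... | yes p | _ = p

distinct⇒lookup-injective : ∀ {A B : Set} (f : A → B) {xs} → AllPairs (λ x y → f x ≢ f y) xs →
                            ∀ {i j} → f (lookup xs i) ≡ f (lookup xs j) → i ≡ j
distinct⇒lookup-injective f (x≢ ∷ _)  {zero}  {zero}  _  = refl
distinct⇒lookup-injective f (x≢ ∷ _)  {zero}  {suc j} eq = contradiction eq (All.lookup x≢ (∈-lookup j))
distinct⇒lookup-injective f (x≢ ∷ _)  {suc i} {zero}  eq = contradiction (sym eq) (All.lookup x≢ (∈-lookup i))
distinct⇒lookup-injective f (_ ∷ pxs) {suc i} {suc j} eq = cong suc (distinct⇒lookup-injective f pxs eq)

deduplicate-distinct : ∀ {A : Set} {R : Rel A 0ℓ} (R? : Decidable₂ R) xs →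
                       AllPairs (λ x y → ¬ R x y) (deduplicate R? xs)
deduplicate-distinct R? []       = []
deduplicate-distinct R? (x ∷ xs) =
  all-filter _ (deduplicate R? xs) ∷ AllPairs.filter⁺ _ (deduplicate-distinct R? xs)

-- The representatives that are kept are pairwise unrelated, so `f` is injective on them.
length-deduplicate≤ : ∀ {A : Set} {P : Pred A 0ℓ} {R : Rel A 0ℓ} (R? : Decidable₂ R) {b} (f : A → Fin b) →
                      (∀ {x y} → P x → P y → f x ≡ f y → R x y) →
                      ∀ {xs} → All P xs → length (deduplicate R? xs) ≤ b
length-deduplicate≤ {P = P} {R} R? f separates {xs} pxs =
  injective⇒≤ (distinct⇒lookup-injective f (distinct (All.deduplicate⁺ R? pxs) (deduplicate-distinct R? xs)))
  where
  distinct : ∀ {ys} → All P ys → AllPairs (λ x y → ¬ R x y) ys → AllPairs (λ x y → f x ≢ f y) ys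
  distinct []         []         = []
  distinct (py ∷ pys) (¬r ∷ ¬rs) =
    All.zipWith (λ (pz , ¬r) eq → ¬r (separates py pz eq)) (pys , ¬r) ∷ distinct pys ¬rs

-- Counting neighbourhoods across a cut by rankings

adjacent⇒≢ : ∀ {V E} (G : Graph V E) {u v} → Adjacent G u v → u ≢ v
adjacent⇒≢ G (e , inj₁ refl) = loopless G e
adjacent⇒≢ G (e , inj₂ refl) = loopless G e ∘ sym

module _ {n m} (G : Graph (Fin n) (Fin m)) where

  -- The ranking `d` may depend on both `v` and `u`. What a set `X ⊆ A` sees outside `A` is then
  -- determined by its maximal rank in each of the `j` rankings.
  record RankedCut (j : ℕ) (A : Subset n) : Set where
    field
      rank     : Fin j → Fin n → ℕ
      dominate : ∀ {v u} → v ∈ A → u ∉ A → Adjacent G v u →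
                 ∃ λ d → ∀ {v′} → v′ ∈ A → rank d v ≤ rank d v′ → Adjacent G v′ u

  neighbour? : ∀ X → Decidable λ u → ∃ λ v → v ∈ X × Adjacent G v u
  neighbour? X u = any? λ v → (v ∈? X) ×-dec adjacent? G v u

  ∈N⁺ : ∀ {X v u} → v ∈ X → Adjacent G v u → u ∈ N G X
  ∈N⁺ {X} v∈X vu = ∈-tabulate⁺ (neighbour? X) (_ , v∈X , vu)

  ∈N⁻ : ∀ {X u} → u ∈ N G X → ∃ λ v → v ∈ X × Adjacent G v u
  ∈N⁻ {X} = ∈-tabulate⁻ (neighbour? X)

  module _ {j A} (C : RankedCut j A) where
    open RankedCut C

    lower? : ∀ d X → Decidable λ v → v ∈ A × ∃ λ x → x ∈ X × rank d v ≤ rank d x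
    lower? d X v = (v ∈? A) ×-dec any? (λ x → (x ∈? X) ×-dec (rank d v ≤? rank d x))

    -- Its size stands in for the maximal rank on `X`: ranks are unbounded, sizes are at most
    -- `∣ A ∣`. For `X ⊆ A`, size 0 means that `X` is empty.
    lowerSet : Fin j → Subset n → Subset n
    lowerSet d X = tabulate (does ∘ lower? d X)

    lowerSet⊆ : ∀ d X → lowerSet d X ⊆ A
    lowerSet⊆ d X = proj₁ ∘ ∈-tabulate⁻ (lower? d X)

    ∣lowerSet∣< : ∀ d X → ∣ lowerSet d X ∣ < suc ∣ A ∣
    ∣lowerSet∣< d X = s≤s (p⊆q⇒∣p∣≤∣q∣ (lowerSet⊆ d X))

    -- The sets lowerSet d X form a chain for each d, so their sizes determine them.
    lowerSet-chain : ∀ d {X Y} → X ⊆ A → ∣ lowerSet d X ∣ ≡ ∣ lowerSet d Y ∣ →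
                     ∀ {x} → x ∈ X → ∃ λ y → y ∈ Y × rank d x ≤ rank d y
    lowerSet-chain d {X} {Y} X⊆A eq {x} x∈X with any? (λ y → (y ∈? Y) ×-dec (rank d x ≤? rank d y))
    ... | yes found = found
    ... | no ¬found = contradiction (sym eq) (<⇒≢ (p⊂q⇒∣p∣<∣q∣
      ( (λ v∈ → let v∈A , y , y∈Y , v≤y = ∈-tabulate⁻ (lower? d Y) v∈ in
                ∈-tabulate⁺ (lower? d X)
                  (v∈A , x , x∈X , ≤-trans v≤y (<⇒≤ (≰⇒> λ x≤y → ¬found (y , y∈Y , x≤y)))))
      , x
      , ∈-tabulate⁺ (lower? d X) (X⊆A x∈X , x , x∈X , ≤-refl)
      , ¬found ∘ proj₂ ∘ ∈-tabulate⁻ (lower? d Y))))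

    code : Subset n → Fin (suc ∣ A ∣ ^ j)
    code X = funToFin λ d → fromℕ< (∣lowerSet∣< d X)

    code-size : ∀ X Y → code X ≡ code Y → ∀ d → ∣ lowerSet d X ∣ ≡ ∣ lowerSet d Y ∣
    code-size X Y eq d = begin
      ∣ lowerSet d X ∣                          ≡⟨ toℕ-fromℕ< _ ⟨
      toℕ (fromℕ< (∣lowerSet∣< d X))            ≡⟨ cong toℕ (finToFun-funToFin _ d) ⟨
      toℕ (finToFun {m = suc ∣ A ∣} (code X) d) ≡⟨ cong (λ c → toℕ (finToFun {m = suc ∣ A ∣} c d)) eq ⟩
      toℕ (finToFun {m = suc ∣ A ∣} (code Y) d) ≡⟨ cong toℕ (finToFun-funToFin _ d) ⟩
      toℕ (fromℕ< (∣lowerSet∣< d Y))            ≡⟨ toℕ-fromℕ< _ ⟩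
      ∣ lowerSet d Y ∣                          ∎
      where open ≡-Reasoning

    code⇒⊆ : ∀ {X Y} → X ⊆ A → Y ⊆ A → code X ≡ code Y → N G X ∩ ∁ A ⊆ N G Y ∩ ∁ A
    code⇒⊆ {X} {Y} X⊆A Y⊆A eq u∈ =
      let u∈NX , u∈∁A        = x∈p∩q⁻ _ _ u∈
          v , v∈X , vu       = ∈N⁻ u∈NX
          d , adjacent       = dominate (X⊆A v∈X) (x∈∁p⇒x∉p u∈∁A) vu
          y , y∈Y , v≤y      = lowerSet-chain d X⊆A (code-size X Y eq d) v∈X
      in x∈p∩q⁺ (∈N⁺ y∈Y (adjacent (Y⊆A y∈Y) v≤y) , u∈∁A)

    nec≤ : nec G A ≤ suc ∣ A ∣ ^ j
    nec≤ = length-deduplicate≤ {P = _⊆ A} (nbhdEquivalent? G A) code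
      (λ {X} {Y} X⊆A Y⊆A eq → ⊆-antisym (code⇒⊆ X⊆A Y⊆A eq) (code⇒⊆ Y⊆A X⊆A (sym eq)))
      (all-filter (_⊆? A) (subsets n))

  nec≤^ : ∀ {j k A} → 1 ≤ n → j ≤ k → RankedCut j A → nec G A ≤ n ^ k
  nec≤^ {j} {k} {A} 1≤n j≤k C with m≤n⇒m<n∨m≡n (∣p∣≤n A)
  ... | inj₁ ∣A∣<n = ≤-trans (nec≤ C) (≤-trans (^-monoˡ-≤ j ∣A∣<n) (^-monoʳ-≤ n {{>-nonZero 1≤n}} j≤k))
  -- Here `suc ∣ A ∣` exceeds `n`, but no vertex lies outside `A`, so zero rankings suffice and
  -- there is a single class.
  ... | inj₂ ∣A∣≡n = ≤-trans (nec≤ {0} trivial) (m^n>0 n {{>-nonZero 1≤n}} k)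
    where
    trivial : RankedCut 0 A
    trivial = record
      { rank     = λ ()
      ; dominate = λ _ u∉A → contradiction (subst (_ ∈_) (sym (∣p∣≡n⇒p≡⊤ ∣A∣≡n)) ∈⊤) u∉A
      }

  singletonCut : ∀ {A v₀} → (∀ {v} → v ∈ A → v ≡ v₀) → RankedCut 1 A
  singletonCut {A} ≡v₀ = record
    { rank     = λ _ _ → 0
    ; dominate = λ v∈A _ vu → zero , λ v′∈A _ →
        subst (λ x → Adjacent G x _) (trans (≡v₀ v∈A) (sym (≡v₀ v′∈A))) vu
    }

-- Initial runs and least elements of decidable predicates

run : {P : Pred ℕ 0ℓ} → Decidable P → ℕ → ℕ
run P? zero    = 0
run P? (suc n) = if does (P? 0) then suc (run (P? ∘ suc) n) else 0

-- Together with `run-complete` this lets run lengths serve as ranks: if one predicate holds up to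
-- `i` and another has at least as long a run, then the other holds at `i` too.
run-sound : ∀ {P : Pred ℕ 0ℓ} (P? : Decidable P) n {i} → i < run P? n → P i
run-sound P? (suc n) {i}     i< with P? 0
run-sound P? (suc n) {zero}  i<       | yes p = p
run-sound P? (suc n) {suc i} (s≤s i<) | yes p = run-sound (P? ∘ suc) n i<

run-complete : ∀ {P : Pred ℕ 0ℓ} (P? : Decidable P) n {i} → i < n → (∀ {j} → j ≤ i → P j) → i < run P? n
run-complete P? (suc n) {i}     i< ps with P? 0
run-complete P? (suc n) {i}     i< ps       | no ¬p = contradiction (ps z≤n) ¬p
run-complete P? (suc n) {zero}  i< ps       | yes p = z<s
run-complete P? (suc n) {suc i} (s≤s i<) ps | yes p = s≤s (run-complete (P? ∘ suc) n i< (ps ∘ s≤s))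

least : ∀ {P : Pred ℕ 0ℓ} → Decidable P → ∀ {n} → P n → ∃ λ m → P m × (∀ {k} → P k → m ≤ k)
least P? {n} pn with P? 0
least P? {n}     pn | yes p = 0 , p , λ _ → z≤n
least P? {zero}  pn | no ¬p = contradiction pn ¬p
least {P} P? {suc n} pn | no ¬p with m , pm , m≤ ← least (P? ∘ suc) pn = suc m , pm , lower
  where
  lower : ∀ {k} → P k → suc m ≤ k
  lower {zero}  pk = contradiction pk ¬p
  lower {suc k} pk = s≤s (m≤ pk)

-- Caterpillars sorted by a key

data Admissible {n} (key : Fin n → ℕ) (S : Fin n → Bool) : Set where
  singleton : ∀ v₀ → (∀ v → S v ≡ true → v ≡ v₀) → Admissible key S
  initial   : ∀ v₀ → (∀ v → S v ≡ true → key v ≤ key v₀) →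
              (∀ v → S v ≢ true → key v₀ ≤ key v) → Admissible key S

module _ {n} (m : Fin (suc n)) {t} (δ : Leaf t ↔ Fin n) where
  open Inverse δ

  private
    to′ : Leaf (node t tt (leaf tt)) → Fin (suc n)
    to′ (left ℓ)     = punchIn m (to ℓ)
    to′ (right here) = m

    from′ : Fin (suc n) → Leaf (node t tt (leaf tt))
    from′ v with m Fin.≟ v
    ... | yes _  = right here
    ... | no m≢v = left (from (punchOut m≢v))

    to′∘from′ : ∀ v → to′ (from′ v) ≡ v
    to′∘from′ v with m Fin.≟ v
    ... | yes m≡v = m≡v
    ... | no m≢v  = trans (cong (punchIn m) (strictlyInverseˡ _)) (punchIn-punchOut m≢v)

    from′∘to′ : ∀ ℓ → from′ (to′ ℓ) ≡ ℓ
    from′∘to′ (left ℓ) with m Fin.≟ punchIn m (to ℓ)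
    ... | yes eq = contradiction (sym eq) (punchInᵢ≢i m (to ℓ))
    ... | no m≢  = cong left (trans (cong from
      (trans (punchOut-cong m refl) (punchOut-punchIn m))) (strictlyInverseʳ ℓ))
    from′∘to′ (right here) with m Fin.≟ m
    ... | yes _  = refl
    ... | no m≢m = contradiction refl m≢m

  addLeaf : Leaf (node t tt (leaf tt)) ↔ Fin (suc n)
  addLeaf = mk↔ₛ′ to′ from′ to′∘from′ from′∘to′

  module _ (key : Fin (suc n) → ℕ) (max : ∀ v → key v ≤ key m)
           (admissible : ∀ w → Admissible (key ∘ punchIn m) λ v → below (from v) w) where

    private
      S : Vertex (node t tt (leaf tt)) → Fin (suc n) → Bool
      S w v = below (from′ v) w

    -- The new vertex `m` is outside every old set and has the largest key, so old initial segments
    -- remain initial.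
    addLeaf-admissible : ∀ w → Admissible key (λ v → below (Inverse.from addLeaf v) w)
    addLeaf-admissible root         = initial m (λ v _ → max v) (λ v ¬S → contradiction refl ¬S)
    addLeaf-admissible (right root) = singleton m only
      where
      only : ∀ v → S (right root) v ≡ true → v ≡ m
      only v eq with m Fin.≟ v
      ... | yes m≡v = sym m≡v
    addLeaf-admissible (left w) with admissible w
    ... | singleton v₀ only = singleton (punchIn m v₀) only′
      where
      only′ : ∀ v → S (left w) v ≡ true → v ≡ punchIn m v₀
      only′ v eq with m Fin.≟ v
      ... | no m≢v = trans (sym (punchIn-punchOut m≢v)) (cong (punchIn m) (only _ eq))
    ... | initial v₀ ≤v₀ v₀≤ = initial (punchIn m v₀) upper lower
      where
      upper : ∀ v → S (left w) v ≡ true → key v ≤ key (punchIn m v₀)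
      upper v eq with m Fin.≟ v
      ... | no m≢v = subst (λ x → key x ≤ _) (punchIn-punchOut m≢v) (≤v₀ _ eq)
      lower : ∀ v → S (left w) v ≢ true → key (punchIn m v₀) ≤ key v
      lower v ≢true with m Fin.≟ v
      ... | yes refl = max _
      ... | no m≢v   = subst (λ x → _ ≤ key x) (punchIn-punchOut m≢v) (v₀≤ _ ≢true)

-- By induction: a vertex of largest key becomes the leaf next to the root, and the other vertices
-- form the other subtree.
sortedCaterpillar : ∀ {n} (key : Fin (suc n) → ℕ) → ∃ λ t → ∃ λ (δ : Leaf t ↔ Fin (suc n)) →
                    ∀ w → Admissible key (λ v → below (Inverse.from δ v) w)
sortedCaterpillar {zero} key = leaf tt ,
  mk↔ₛ′ (λ _ → zero) (λ _ → here) (λ { zero → refl }) (λ { here → refl }) ,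
  λ { root → singleton zero (λ { zero _ → refl }) }
sortedCaterpillar {suc n} key =
  let m           = argmax key zero (allFin _)
      _ , δ , adm = sortedCaterpillar (key ∘ punchIn m)
  in _ , addLeaf m δ , addLeaf-admissible m δ key
       (λ v → All.lookup (f[xs]≤f[argmax] {f = key} zero (allFin _)) (∈-allFin v)) adm

-- Coordinates along the subdivided edges

module _ {h k n m} (H : Graph (Fin h) (Fin k)) (G : Graph (Fin n) (Fin m)) (G/H : G IsGraphOver H) where
  open _IsGraphOver_ G/H

  Incident : Fin h → Set
  Incident b = ∃ λ e → src H e ≡ b ⊎ tgt H e ≡ b

  incident? : Decidable Incident
  incident? b = any? λ e → (src H e Fin.≟ b) ⊎-dec (tgt H e Fin.≟ b)

  -- The i-th vertex of the path replacing e; all i > s e give its end.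
  position : Fin k → ℕ → SubVertex H s
  position e zero    = inj₁ (src H e)
  position e (suc i) with i <? s e
  ... | yes i<s = inj₂ (e , fromℕ< i<s)
  ... | no _    = inj₁ (tgt H e)

  position-last : ∀ e → position e (suc (s e)) ≡ inj₁ (tgt H e)
  position-last e with s e <? s e
  ... | yes s<s = contradiction s<s (<-irrefl refl)
  ... | no _    = refl

  position-inner : ∀ e i → position e (suc (toℕ i)) ≡ inj₂ (e , i)
  position-inner e i with toℕ i <? s e
  ... | yes i<s = cong (λ j → inj₂ (e , j)) (Fin.fromℕ<-toℕ i i<s)
  ... | no i≮s  = contradiction (toℕ<n i) i≮s

  position-inj₁ : ∀ e i {b} → position e i ≡ inj₁ b → Incident b
  position-inj₁ e zero    refl = e , inj₁ refl
  position-inj₁ e (suc i) eq with i <? s e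
  position-inj₁ e (suc i) refl | no _ = e , inj₂ refl

  position-inj₂ : ∀ e i {e′ j} → position e i ≡ inj₂ (e′ , j) → e ≡ e′ × i ≡ suc (toℕ j)
  position-inj₂ e (suc i) eq with i <? s e
  position-inj₂ e (suc i) refl | yes i<s = refl , cong suc (sym (toℕ-fromℕ< i<s))

  -- The bound makes `position e (suc i)` an inner vertex, which lies on one path only; vertices of
  -- `H` may lie on several.
  position-injective : ∀ {e i e′ i′} → i < s e → position e′ i′ ≡ position e (suc i) → e′ ≡ e × i′ ≡ suc i
  position-injective {e} {i} {e′} {i′} i<s eq =
    let e≡ , i≡ = position-inj₂ e′ i′ (trans eq (trans
                    (cong (position e ∘ suc) (sym (toℕ-fromℕ< i<s))) (position-inner e (fromℕ< i<s))))
    in e≡ , trans i≡ (cong suc (toℕ-fromℕ< i<s))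

  subSrc-position : ∀ e i → subSrc H s (e , i) ≡ position e (toℕ i)
  subSrc-position e zero    = refl
  subSrc-position e (suc i) = sym (position-inner e i)

  subTgt-position : ∀ e i → subTgt H s (e , i) ≡ position e (suc (toℕ i))
  subTgt-position e i with view i
  ... | ‵fromℕ     = sym (trans (cong (position e ∘ suc) (Fin.toℕ-fromℕ (s e))) (position-last e))
  ... | ‵inject₁ j = sym (trans (cong (position e ∘ suc) (Fin.toℕ-inject₁ j)) (position-inner e j))

  data Step : Rel (SubVertex H s) 0ℓ where
    up   : ∀ {e i} → i ≤ s e → Step (position e i) (position e (suc i))
    down : ∀ {e i} → i ≤ s e → Step (position e (suc i)) (position e i)

  adjacent⇒step : ∀ {v x y} → Adjacent (subdivide H s [ M v ]) x y → Step (proj₁ x) (proj₁ y)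
  adjacent⇒step (((e , i) , _) , inj₁ refl)
    rewrite subSrc-position e i | subTgt-position e i = up (s≤s⁻¹ (toℕ<n i))
  adjacent⇒step (((e , i) , _) , inj₂ refl)
    rewrite subSrc-position e i | subTgt-position e i = down (s≤s⁻¹ (toℕ<n i))

  isolated-step : ∀ {b x} → ¬ Incident b → ¬ Step (inj₁ b) x
  isolated-step isolated step = go step refl
    where
    go : ∀ {y x} → Step y x → ¬ y ≡ inj₁ _
    go (up {e} {i} _)   eq = isolated (position-inj₁ e i eq)
    go (down {e} {i} _) eq = isolated (position-inj₁ e (suc i) eq)

  isolated-walk : ∀ {v b p y} → ¬ Incident b →
                  Star (Adjacent (subdivide H s [ M v ])) (inj₁ b , p) y → proj₁ y ≡ inj₁ b
  isolated-walk isolated ε          = refl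
  isolated-walk isolated (step ◅ _) = contradiction (adjacent⇒step step) (isolated-step isolated)

  -- Levels and keys

  infix 4 _∈ᴹ_
  _∈ᴹ_ : SubVertex H s → Fin n → Set
  x ∈ᴹ v = T (M v x)

  level : SubVertex H s → ℕ
  level (inj₁ b)       = if does (incident? b) then h else toℕ b
  level (inj₂ (e , i)) = h + suc (toℕ i)

  level-incident : ∀ {b} → Incident b → level (inj₁ b) ≡ h
  level-incident {b} inc with incident? b
  ... | yes _   = refl
  ... | no ¬inc = contradiction inc ¬inc

  level-isolated : ∀ {b} → ¬ Incident b → level (inj₁ b) ≡ toℕ b
  level-isolated {b} ¬inc with incident? b
  ... | yes inc = contradiction inc ¬inc
  ... | no _    = refl

  level<h : ∀ {x} → level x < h → ∃ λ b → x ≡ inj₁ b × ¬ Incident b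
  level<h {inj₁ b} l<h with incident? b
  ... | yes _   = contradiction l<h (<-irrefl refl)
  ... | no ¬inc = b , refl , ¬inc
  level<h {inj₂ _} l<h = contradiction l<h (≤⇒≯ (m≤m+n h _))

  -- Not an equality, because the target has level `h` however long the path is.
  level-position : ∀ e i → level (position e i) ≤ h + i
  level-position e zero rewrite level-incident (e , inj₁ refl) = m≤m+n h 0
  level-position e (suc i) with i <? s e
  ... | yes i<s rewrite toℕ-fromℕ< i<s = ≤-refl
  ... | no _ rewrite level-incident (e , inj₂ refl) = m≤m+n h (suc i)

  Occurs : Fin n → ℕ → Set
  Occurs v l = ∃ λ x → level x ≡ l × x ∈ᴹ v

  occurs? : ∀ v → Decidable (Occurs v)
  occurs? v l with any? (λ b → (level (inj₁ b) ≟ l) ×-dec T? (M v (inj₁ b)))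
                 | any? (λ e → any? λ i → (level (inj₂ (e , i)) ≟ l) ×-dec T? (M v (inj₂ (e , i))))
  ... | yes (b , p) | _               = yes (inj₁ b , p)
  ... | no _        | yes (e , i , p) = yes (inj₂ (e , i) , p)
  ... | no ¬p       | no ¬q           = no λ { (inj₁ b , p) → ¬p (b , p) ; (inj₂ (e , i) , p) → ¬q (e , i , p) }

  leastLevel : ∀ v → ∃ λ l → Occurs v l × (∀ {l′} → Occurs v l′ → l ≤ l′)
  leastLevel v = let x , x∈v = nonEmpty v in least (occurs? v) (x , refl , x∈v)

  key : Fin n → ℕ
  key v = proj₁ (leastLevel v)

  bottom : ∀ v → Occurs v (key v)
  bottom v = proj₁ (proj₂ (leastLevel v))

  key≤level : ∀ {v x} → x ∈ᴹ v → key v ≤ level x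
  key≤level {v} x∈v = proj₂ (proj₂ (leastLevel v)) (_ , refl , x∈v)

  meet : ∀ {v u} → Adjacent G v u → ∃ λ x → x ∈ᴹ v × x ∈ᴹ u
  meet {v} {u} vu = Equivalence.to (IsIntersectionGraph.adjacent isIntersection v u (adjacent⇒≢ G vu)) vu

  meet⁻¹ : ∀ {v u x} → v ≢ u → x ∈ᴹ v → x ∈ᴹ u → Adjacent G v u
  meet⁻¹ {v} {u} v≢u x∈v x∈u =
    Equivalence.from (IsIntersectionGraph.adjacent isIntersection v u v≢u) (_ , x∈v , x∈u)

  ∈∉⇒≢ : ∀ {A : Subset n} {v u} → v ∈ A → u ∉ A → v ≢ u
  ∈∉⇒≢ v∈A u∉A refl = u∉A v∈A

  walk : ∀ {v x y} (x∈v : x ∈ᴹ v) (y∈v : y ∈ᴹ v) → Star (Adjacent (subdivide H s [ M v ])) (x , x∈v) (y , y∈v)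
  walk {v} x∈v y∈v = connected v _ _

  isolated-only : ∀ {v b x} → ¬ Incident b → inj₁ b ∈ᴹ v → x ∈ᴹ v → x ≡ inj₁ b
  isolated-only isolated b∈v x∈v = isolated-walk isolated (walk b∈v x∈v)

  -- Stretches covered at a cut of level `t`

  module _ (t : ℕ) where

    -- Vertices outside A only see levels ≥ t, so a forward stretch may skip the positions below t.
    Forward Backward : Fin n → Fin k → ℕ → Set
    Forward  v e i = t ≤ h + i → position e i ∈ᴹ v
    Backward v e i = position e (suc (s e) ∸ i) ∈ᴹ v

    forward? : ∀ v e → Decidable (Forward v e)
    forward? v e i = (t ≤? h + i) →-dec T? (M v (position e i))

    backward? : ∀ v e → Decidable (Backward v e)
    backward? v e i = T? (M v (position e (suc (s e) ∸ i)))

    Reaches : Fin n → Fin k → ℕ → Set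
    Reaches v e i = (∀ {j} → j ≤ i → Forward v e j) ⊎ (∀ {j} → i ≤ j → j ≤ suc (s e) → position e j ∈ᴹ v)

    -- A vertex of `H` may lie on several paths, so a walk through it may switch to another `e`. The
    -- bound on `i` excludes the padding beyond the target.
    Reached : Fin n → SubVertex H s → Set
    Reached v x = ∃₂ λ e i → i ≤ suc (s e) × position e i ≡ x × Reaches v e i

    -- A step away from an end of a path starts a fresh stretch, made of `x` and `y`. Otherwise `x`
    -- is an inner vertex, so its coordinates are forced, and the stretch already known grows or
    -- shrinks by one.
    reached-step : ∀ {v x y} → Step x y → x ∈ᴹ v → y ∈ᴹ v → Reached v x → Reached v y
    reached-step (up {e} {zero} i≤s) x∈v y∈v _ = e , 1 , s≤s z≤n , refl , inj₁ λ where
      z≤n       _ → x∈v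
      (s≤s z≤n) _ → y∈v
    reached-step {v} (up {e} {suc i} i<s) x∈v y∈v (e′ , i′ , _ , eq , reach)
      with position-injective {e} {i} {e′} {i′} i<s eq
    ... | refl , refl = e , suc (suc i) , s≤s i<s , refl , go reach
      where
      go : Reaches v e (suc i) → Reaches v e (suc (suc i))
      go (inj₁ f) = inj₁ extended
        where
        extended : ∀ {j} → j ≤ suc (suc i) → Forward v e j
        extended j≤ t≤ with m≤n⇒m<n∨m≡n j≤
        ... | inj₁ j<   = f (s≤s⁻¹ j<) t≤
        ... | inj₂ refl = y∈v
      go (inj₂ f) = inj₂ λ i≤j → f (≤-trans (n≤1+n _) i≤j)
    reached-step {v} (down {e} {i} i≤s) x∈v y∈v (e′ , i′ , _ , eq , reach) with m≤n⇒m<n∨m≡n i≤s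
    ... | inj₂ refl = e , i , n≤1+n _ , refl , inj₂ two
      where
      two : ∀ {j} → i ≤ j → j ≤ suc i → position e j ∈ᴹ v
      two i≤j j≤ with m≤n⇒m<n∨m≡n i≤j
      ... | inj₂ refl = y∈v
      ... | inj₁ i<j with ≤-antisym j≤ i<j
      ... | refl = x∈v
    ... | inj₁ i<s with position-injective {e} {i} {e′} {i′} i<s eq
    ... | refl , refl = e , i , m≤n⇒m≤1+n i≤s , refl , go reach
      where
      go : Reaches v e (suc i) → Reaches v e i
      go (inj₁ f) = inj₁ λ j≤i → f (m≤n⇒m≤1+n j≤i)
      go (inj₂ f) = inj₂ extended
        where
        extended : ∀ {j} → i ≤ j → j ≤ suc (s e) → position e j ∈ᴹ v
        extended i≤j j≤ with m≤n⇒m<n∨m≡n i≤j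
        ... | inj₁ i<j  = f i<j j≤
        ... | inj₂ refl = y∈v

    reached-walk : ∀ {v x y} → Star (Adjacent (subdivide H s [ M v ])) x y →
                   Reached v (proj₁ x) → Reached v (proj₁ y)
    reached-walk ε = id
    reached-walk {x = x} (_◅_ {j = z} step steps) =
      reached-walk steps ∘ reached-step (adjacent⇒step step) (proj₂ x) (proj₂ z)

    reached-start : ∀ {v x} → x ∈ᴹ v → level x ≤ t → (∃ λ b → x ≡ inj₁ b × ¬ Incident b) ⊎ Reached v x
    reached-start {v} {inj₁ b} x∈v _ with incident? b
    ... | no ¬inc             = inj₁ (b , refl , ¬inc)
    ... | yes (e , inj₁ refl) = inj₂ (e , 0 , z≤n , refl , inj₁ λ { z≤n _ → x∈v })
    ... | yes (e , inj₂ refl) = inj₂ (e , suc (s e) , ≤-refl , position-last e , inj₂ last)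
      where
      last : ∀ {j} → suc (s e) ≤ j → j ≤ suc (s e) → position e j ∈ᴹ v
      last j≥ j≤ with ≤-antisym j≥ j≤
      ... | refl = subst (_∈ᴹ v) (sym (position-last e)) x∈v
    reached-start {v} {inj₂ (e , i)} x∈v l≤t = inj₂
      (e , suc (toℕ i) , m≤n⇒m≤1+n (toℕ<n i) , position-inner e i , inj₁ only)
      where
      only : ∀ {j} → j ≤ suc (toℕ i) → Forward v e j
      -- As `level x ≤ t ≤ h + j`, only the position of `x` itself is demanded; `Forward` is vacuous
      -- at the lower ones.
      only j≤ t≤ with ≤-antisym j≤ (+-cancelˡ-≤ h _ _ (≤-trans l≤t t≤))
      ... | refl = subst (_∈ᴹ v) (sym (position-inner e i)) x∈v

    -- The path of `e` has `2 + s e` positions, both ends included; backward runs count from the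
    -- target.
    rank : Fin 2 → Fin k → Fin n → ℕ
    rank zero       e v = run (forward? v e) (2 + s e)
    rank (suc zero) e v = run (backward? v e) (2 + s e)

    -- Ranked cuts for initial segments

    module _ {A : Subset n} (A≤t : ∀ {v} → v ∈ A → key v ≤ t) (t≤∁A : ∀ {u} → u ∉ A → t ≤ key u) where

      edgeCut : h ≤ t → RankedCut G (2 * k) A
      edgeCut h≤t = record { rank = λ d → uncurry rank (remQuot k d) ; dominate = dominate }
        where
        Dominates : Fin n → Fin n → Fin 2 × Fin k → Set
        Dominates v u (i , e) = ∀ {v′} → v′ ∈ A → rank i e v ≤ rank i e v′ → Adjacent G v′ u

        dominate-reached : ∀ {v u x} → u ∉ A → x ∈ᴹ u → Reached v x → ∃ (Dominates v u)
        dominate-reached {u = u} u∉A x∈u (e , i , i≤ , refl , inj₁ f) = (zero , e) , λ {v′} v′∈A v≤v′ →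
          meet⁻¹ (∈∉⇒≢ v′∈A u∉A)
            (run-sound (forward? v′ e) (2 + s e)
              (<-≤-trans (run-complete (forward? _ e) (2 + s e) (s≤s i≤) f) v≤v′)
              -- The premise of `Forward` holds at `i`, since `u` contains nothing below level `t`.
              (≤-trans (t≤∁A u∉A) (≤-trans (key≤level x∈u) (level-position e i))))
            x∈u
        dominate-reached {v} {u} u∉A x∈u (e , i , i≤ , refl , inj₂ f) = (suc zero , e) , λ {v′} v′∈A v≤v′ →
          meet⁻¹ (∈∉⇒≢ v′∈A u∉A)
            -- Position `i` has index `suc (s e) ∸ i` from the target; reversing twice gives `i`
            -- back.
            (subst (λ j → position e j ∈ᴹ v′) (m∸[m∸n]≡n i≤)
              (run-sound (backward? v′ e) (2 + s e)
                (<-≤-trans (run-complete (backward? v e) (2 + s e) (s≤s (m∸n≤m (suc (s e)) i)) reach) v≤v′)))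
            x∈u
          where
          reach : ∀ {j} → j ≤ suc (s e) ∸ i → Backward v e j
          reach {j} j≤ = f (subst (_≤ suc (s e) ∸ j) (m∸[m∸n]≡n i≤) (∸-monoʳ-≤ (suc (s e)) j≤)) (m∸n≤m _ j)

        dominate-pair : ∀ {v u} → v ∈ A → u ∉ A → Adjacent G v u → ∃ (Dominates v u)
        dominate-pair {v} {u} v∈A u∉A vu with bottom v | meet vu
        ... | a , a≡ , a∈v | x , x∈v , x∈u with reached-start a∈v (≤-trans (≤-reflexive a≡) (A≤t v∈A))
        ... | inj₂ reached = dominate-reached u∉A x∈u (reached-walk (walk a∈v x∈v) reached)
        -- If `M v` is an isolated vertex, then `u` contains it too, at a level below `h ≤ t`, which
        -- is too low for a vertex outside `A`.
        ... | inj₁ (b , refl , ¬inc) with isolated-only {x = x} ¬inc a∈v x∈v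
        ... | refl = contradiction (≤-trans h≤t (≤-trans (t≤∁A u∉A) (key≤level x∈u)))
                                   (<⇒≱ (subst (_< h) (sym (level-isolated ¬inc)) (toℕ<n b)))

        dominate : ∀ {v u} → v ∈ A → u ∉ A → Adjacent G v u → ∃ (Dominates v u ∘ remQuot k)
        dominate {v} {u} v∈A u∉A vu =
          let (i , e) , dom = dominate-pair v∈A u∉A vu
          in combine i e , λ {v′} → subst (Dominates v u) (sym (remQuot-combine i e)) dom {v′}

      -- Each `M v` with `v ∈ A` is a single isolated vertex, of level at most `t`. If it meets some
      -- `M u` with `u ∉ A`, its level is exactly `t`, which identifies it as `b`. So containing `b`
      -- is all that matters.
      isolatedCut : t < h → RankedCut G 1 A
      isolatedCut t<h = record { rank = λ _ → rank′ ; dominate = dominate }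
        where
        b : Fin h
        b = fromℕ< t<h

        rank′ : Fin n → ℕ
        rank′ v = if M v (inj₁ b) then 1 else 0

        rank′⁺ : ∀ {v} → inj₁ b ∈ᴹ v → 1 ≤ rank′ v
        rank′⁺ {v} b∈v with true ← M v (inj₁ b) = ≤-refl

        rank′⁻ : ∀ {v} → 1 ≤ rank′ v → inj₁ b ∈ᴹ v
        rank′⁻ {v} 1≤ with true ← M v (inj₁ b) = _

        dominate : ∀ {v u} → v ∈ A → u ∉ A → Adjacent G v u →
                   ∃ λ (d : Fin 1) → ∀ {v′} → v′ ∈ A → rank′ v ≤ rank′ v′ → Adjacent G v′ u
        dominate {v} {u} v∈A u∉A vu with bottom v | meet vu
        ... | a , a≡ , a∈v | x , x∈v , x∈u with level<h {a} (≤-<-trans (≤-trans (≤-reflexive a≡) (A≤t v∈A)) t<h)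
        ... | b′ , refl , ¬inc with isolated-only {x = x} ¬inc a∈v x∈v
        ... | refl with toℕ-injective {i = b′} {j = b} (trans b′≡t (sym (toℕ-fromℕ< t<h)))
          where
          b′≡t : toℕ b′ ≡ t
          b′≡t = trans (sym (level-isolated ¬inc)) (≤-antisym
            (≤-trans (≤-reflexive a≡) (A≤t v∈A)) (≤-trans (t≤∁A u∉A) (key≤level x∈u)))
        ... | refl = zero , λ {v′} v′∈A v≤v′ →
          meet⁻¹ (∈∉⇒≢ v′∈A u∉A) (rank′⁻ (≤-trans (rank′⁺ a∈v) v≤v′)) x∈u

  -- From cuts to the width of the caterpillar

  Admissible⇒nec≤ : ∀ {S} → 1 ≤ n → Admissible key S → nec G (tabulate S) ≤ n ^ (1 ⊔ 2 * ‖ H ‖)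
  Admissible⇒nec≤ {S} 1≤n = λ where
      (singleton v₀ only)  → nec≤^ G 1≤n (m≤m⊔n 1 (2 * k)) (singletonCut G (only _ ∘ ∈⁻))
      (initial v₀ ≤v₀ v₀≤) → initialCut v₀ (≤v₀ _ ∘ ∈⁻) (v₀≤ _ ∘ ∉⁻)
    where
    ∈⁻ : ∀ {v} → v ∈ tabulate S → S v ≡ true
    ∈⁻ {v} v∈ = trans (sym (lookup∘tabulate S v)) ([]=⇒lookup v∈)

    ∉⁻ : ∀ {v} → v ∉ tabulate S → S v ≢ true
    ∉⁻ {v} v∉ eq = v∉ (lookup⇒[]= v _ (trans (lookup∘tabulate S v) eq))

    initialCut : ∀ v₀ → (∀ {v} → v ∈ tabulate S → key v ≤ key v₀) → (∀ {v} → v ∉ tabulate S → key v₀ ≤ key v) →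
                 nec G (tabulate S) ≤ n ^ (1 ⊔ 2 * ‖ H ‖)
    initialCut v₀ ≤v₀ v₀≤ with key v₀ <? h
    ... | yes t<h = nec≤^ G 1≤n (m≤m⊔n 1 (2 * k)) (isolatedCut (key v₀) ≤v₀ v₀≤ t<h)
    ... | no t≮h  = nec≤^ G 1≤n (m≤n⊔m 1 (2 * k)) (edgeCut (key v₀) ≤v₀ v₀≤ (≮⇒≥ t≮h))

corollary2 : ∀ {h k} (H : Graph (Fin h) (Fin k)) →
    ∀ {n m} (G : Graph (Fin n) (Fin m)) → G IsGraphOver H → 2 ≤ n →
    booleanWidth G ≤ᴿ (1 ⊔ 2 * ‖ H ‖) · log n
corollary2 H {n = n@(suc _)} G G/H 2≤n p q width≥ =
  let t , δ , admissible = sortedCaterpillar (key H G G/H)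
      -- A lower bound `p / q` on the minimum applies to the caterpillar, and `w` is a tree vertex
      -- whose cut meets it.
      w , 2^p≤           = width≥ (record { tree = t ; δ = δ })
      K                  = 1 ⊔ 2 * ‖ H ‖
      nec≤               = Admissible⇒nec≤ H G G/H (s≤s z≤n) (admissible w)
  in begin
    2 ^ p                                                 ≤⟨ 2^p≤ ⟩
    nec G (tabulate λ v → below (Inverse.from δ v) w) ^ q ≤⟨ ^-monoˡ-≤ q nec≤ ⟩
    (n ^ K) ^ q                                           ≡⟨ ^-*-assoc n K q ⟩
    n ^ (K * q)                                           ≡⟨ cong (n ^_) (*-comm K q) ⟩
    n ^ (q * K)                                           ∎
  where open ≤-Reasoning
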